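{- Let $(G,l,A,\sigma)$ be a labelled graph with multiplicity on $n$ vertices and let $1,k$ be two distinct vertices of $G$ with $\{1,k\}\notin E_G$. Suppose the collapse of $1$ and $k$ is simple. Then there exist a (nonempty) finite number of matrices $C_{1\equiv k}$ such that $$\mathcal{A}_G\,C_{1\equiv k}=\mathcal{A}_{G_{1\equiv k}}.$$ If $\mathcal{A}_G$ is written in block form $(F,N)$, where $F$ (resp. $N$) is the matrix of the exponents of the images of the feasible (resp. non-feasible) variables, then $C_{1\equiv k}$ is a $2^{n-1}\times2^{n-2}$ matrix of the block form $$C_{1\equiv k}=\begin{pmatrix}\operatorname{id}\\0\end{pmatrix}.$$
   Context: Graphs are finite and simple, $G=(V_G;E_G)$ with $|V_G|=n$. Partitions. For a finite nonempty set $V$, $\Pi_V$ is the set of unordered pairs $A|B$ with $A\cup B=V$, $A\cap B=\emptyset$ (one of $A,B$ may be empty; $A|B=B|A$). $Cut_G(A|B)$ is the set of edges of $G$ with one endpoint in $A$ and the other in $B$. Labelled graphs with multiplicity. A labeling is a surjective map $l:E_G\to A$ onto a set $A$ of labels. A multiplicity map is a map $\sigma:E_G\to\mathbb{Z}\setminus\{0\}$. Then $(G,l,A,\sigma)$ is a labelled graph with multiplicity. The matrix $\mathcal{A}$. The toric map $\phi_{(G,l,A,\sigma)}$ sends the variable $r_p$ ($p\in\Pi_{V_G}$) to $\prod_{e\in Cut_G(p)}s_{l(e)}^{\sigma(e)}\prod_{e\in E_G\setminus Cut_G(p)}t_{l(e)}^{\sigma(e)}$ in variables $s_a,t_a$ ($a\in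 A$). $\mathcal{A}_G=\mathcal{A}_{(G,l,A,\sigma)}$ is the integer matrix with rows indexed by the $s_a$ and $t_a$, $a\in A$, and columns indexed by $\Pi_{V_G}$ (in some chosen order), the column of $p$ being the exponent vector of the image of $r_p$. Collapse. Let $\{1,k\}\notin E_G$. The collapsed graph $G_{1\equiv k}$ has vertex set $V_G\setminus\{k\}$ and edge set $E'$ obtained from $E_G$ by replacing each edge $\{i,k\}$ by $\{i,1\}$, keeping only one copy of repeated edges. The collapse is simple if $|E_G|=|E'|$, i.e. no vertex is adjacent to both $1$ and $k$; in that case the edges of $G_{1\equiv k}$ correspond bijectively to those of $G$, and $G_{1\equiv k}$ carries the label set, labels and multiplicities transported along this bijection (so the rows of $\mathcal{A}_{G_{1\equiv k}}$ and $\mathcal{A}_G$ are indexed by the same set). Feasibility. A partition $A|B\in\Pi_{V_G}$ is feasible if $1$ and $k$ lie both in $A$ or both in $B$; the variable $r_{A|B}$ is then feasible, otherwise non-feasible. For $p\in\Pi_{V_G\setminus\{k\}}$, $p_f\in\Pi_{V_G}$ is the feasible partition obtained by adding $k$ to the part of $p$ containing $1$; $p\mapsto p_f$ is a bijection onto the feasible partitions. In the block form, the columns of $F$ are ordered so that $p_f$ is in the position of $p$ in the chosen order of the columns of $\mathcal{A}_{G_{1\equiv k}}$.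
   Formalization: The integer solutions C of A_G C = A_{G_{1≡k}} are always infinitely many (A_G has a kernel); so C_{1≡k} means the solution that has the form (id;0) when A_G is in block form, and the finite nonempty number counts these matrices as the column orders vary. -}

module Defs where

open import Algebra.Properties.CommutativeMonoid.Sum using ()
open import Data.Bool.Base using (Bool; _∧_; _∨_; if_then_else_)
open import Data.Fin.Base using (Fin; zero; suc; cast; punchOut; splitAt; _↑ˡ_; _↑ʳ_)
open import Data.Fin.Properties using (_≟_; punchOut-injective; cast-involutive)
open import Data.Fin.Subset using (Subset; _∈_; _∪_; _∩_; ⊤; ⊥)
open import Data.Fin.Subset.Properties using (_∈?_)
open import Data.Integer.Base using (ℤ; 0ℤ; 1ℤ) renaming (_+_ to _+ℤ_; _*_ to _*ℤ_)
open import Data.Integer.Properties using (+-0-commutativeMonoid)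
open import Data.List.Base using (List; []; _∷_; map; length; lookup; filter; foldr; deduplicate; allFin)
open import Data.List.Properties using (length-map; length-filter; length-deduplicate; filter-complete)
open import Data.List.Relation.Unary.All using (All)
open import Data.List.Relation.Unary.Any using (Any)
import Data.List.Relation.Unary.All as All
import Data.List.Relation.Unary.All.Properties as All
import Data.List.Relation.Unary.Unique.Setoid as Unique
import Data.List.Relation.Unary.Unique.DecSetoid.Properties as Unique
open import Data.Nat.Base using (ℕ; zero; suc; _+_; _^_)
open import Data.Nat.Properties using (suc-injective; ≤-antisym; ≤-trans; ≤-reflexive)
open import Data.Product.Base using (_×_; _,_; proj₁; proj₂)
open import Data.Sum.Base using (_⊎_; inj₁; inj₂; [_,_]′)
import Data.Sum.Properties as Sum
open import Data.Vec.Base using (insertAt; replicate; zipWith; head; tail; []; _∷_) renaming (lookup to lookupᵛ)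
open import Function.Base using (_∘_)
open import Function.Bundles using (Inverse)
open import Function.Definitions using (Surjective)
open import Level using (0ℓ)
open import Relation.Binary.Bundles using (Setoid; DecSetoid)
open import Relation.Binary.Core using (Rel)
open import Relation.Binary.Definitions using (Decidable; DecidableEquality)
open import Relation.Binary.PropositionalEquality using (_≡_; _≢_; refl; sym; trans; cong; cong₂)
import Relation.Binary.PropositionalEquality as ≡
open import Relation.Binary.Structures using (IsEquivalence)
open import Relation.Nullary using (¬_; yes; no; does)
open import Relation.Nullary.Decidable using (¬?; _×-dec_; _⊎-dec_)
import Relation.Unary as U

open Algebra.Properties.CommutativeMonoid.Sum +-0-commutativeMonoid using (sum)

infix 4 _≈ᵘ_

_≈ᵘ_ : {X : Set} → Rel (X × X) 0ℓ
(a , b) ≈ᵘ (c , d) = (a ≡ c × b ≡ d) ⊎ (a ≡ d × b ≡ c)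

≈ᵘ-isEquivalence : {X : Set} → IsEquivalence (_≈ᵘ_ {X})
≈ᵘ-isEquivalence = record
  { refl  = inj₁ (refl , refl)
  ; sym   = λ { (inj₁ (refl , refl)) → inj₁ (refl , refl)
              ; (inj₂ (refl , refl)) → inj₂ (refl , refl) }
  ; trans = λ { (inj₁ (refl , refl)) q                    → q
              ; (inj₂ (refl , refl)) (inj₁ (refl , refl)) → inj₂ (refl , refl)
              ; (inj₂ (refl , refl)) (inj₂ (refl , refl)) → inj₁ (refl , refl) }
  }

≈ᵘ-dec : {X : Set} → DecidableEquality X → Decidable (_≈ᵘ_ {X})
≈ᵘ-dec _≟ₓ_ (a , b) (c , d) =
  ((a ≟ₓ c) ×-dec (b ≟ₓ d)) ⊎-dec ((a ≟ₓ d) ×-dec (b ≟ₓ c))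

pairDecSetoid : ℕ → DecSetoid 0ℓ 0ℓ
pairDecSetoid n = record
  { Carrier = Fin n × Fin n
  ; _≈_ = _≈ᵘ_
  ; isDecEquivalence = record { isEquivalence = ≈ᵘ-isEquivalence ; _≟_ = ≈ᵘ-dec _≟_ }
  }

-- The edge set is listed without repetition, each edge {i,j} being written
-- as (i , j) or as (j , i); the edges are then referred to by position.
record Graph (n : ℕ) : Set where
  field
    edges    : List (Fin n × Fin n)
    loopless : All (λ (i , j) → i ≢ j) edges
    distinct : Unique.Unique (DecSetoid.setoid (pairDecSetoid n)) edges

  ∣E∣ : ℕ
  ∣E∣ = length edges

  Edge : Set
  Edge = Fin ∣E∣

  endpoints : Edge → Fin n × Fin n
  endpoints = lookup edges

  Adjacent : Rel (Fin n) 0ℓ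
  Adjacent i j = Any ((i , j) ≈ᵘ_) edges

record LabelledGraph (n : ℕ) (A : Set) : Set where
  field
    graph            : Graph n
    _≟ᴬ_             : DecidableEquality A
  open Graph graph public
  field
    label            : Edge → A
    label-surjective : Surjective _≡_ _≡_ label
    σ                : Edge → ℤ
    σ≢0              : ∀ e → σ e ≢ 0ℤ

record Bipartition (n : ℕ) : Set where
  constructor _∣_⟨_,_⟩
  field
    A B      : Subset n
    covering : A ∪ B ≡ ⊤
    disjoint : A ∩ B ≡ ⊥

  parts : Subset n × Subset n
  parts = A , B

Π : ℕ → Setoid 0ℓ 0ℓ
Π n = record
  { Carrier = Bipartition n
  ; _≈_ = λ p q → Bipartition.parts p ≈ᵘ Bipartition.parts q
  ; isEquivalence = record
    { refl = E.refl ; sym = E.sym ; trans = E.trans }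
  }
  where module E = IsEquivalence (≈ᵘ-isEquivalence {Subset n})

Matrix : Set → Set → Set
Matrix R C = R → C → ℤ

infix  4 _≈ᴹ_
infixl 7 _⊗_

_≈ᴹ_ : {R C : Set} → Rel (Matrix R C) 0ℓ
M ≈ᴹ N = ∀ i j → M i j ≡ N i j

_⊗_ : {R C : Set} {k : ℕ} → Matrix R (Fin k) → Matrix (Fin k) C → Matrix R C
(M ⊗ N) i j = sum (λ h → M i h *ℤ N h j)

Var : Set → Set
Var A = A ⊎ A

pattern s a = inj₁ a
pattern t a = inj₂ a

-- A Laurent monomial in the variables s a and t a, given by its exponents.
Monomial : Set → Set
Monomial A = Var A → ℤ

module ToricMap {n : ℕ} {A : Set} (G : LabelledGraph n A) where
  open LabelledGraph G

  𝟙 : Monomial A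
  𝟙 _ = 0ℤ

  _·_ : Monomial A → Monomial A → Monomial A
  (f · g) x = f x +ℤ g x

  _^^_ : Var A → ℤ → Monomial A
  (x ^^ z) y = if does (Sum.≡-dec _≟ᴬ_ _≟ᴬ_ x y) then z else 0ℤ

  ∏ : List Edge → (Edge → Monomial A) → Monomial A
  ∏ es f = foldr (λ e → f e ·_) 𝟙 es

  InCut : Bipartition n → U.Pred Edge 0ℓ
  InCut p e = (i ∈ P.A × j ∈ P.B) ⊎ (i ∈ P.B × j ∈ P.A)
    where
    module P = Bipartition p
    i = proj₁ (endpoints e)
    j = proj₂ (endpoints e)

  inCut? : ∀ p → U.Decidable (InCut p)
  inCut? p e = ((_ ∈? _) ×-dec (_ ∈? _)) ⊎-dec ((_ ∈? _) ×-dec (_ ∈? _))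

  Cut NonCut : Bipartition n → List Edge
  Cut    p = filter (inCut? p) (allFin ∣E∣)
  NonCut p = filter (¬? ∘ inCut? p) (allFin ∣E∣)

  φ : Bipartition n → Monomial A
  φ p = ∏ (Cut p) (λ e → s (label e) ^^ σ e) · ∏ (NonCut p) (λ e → t (label e) ^^ σ e)

ColumnOrder : ℕ → ℕ → Set
ColumnOrder N n = Inverse (≡.setoid (Fin N)) (Π n)

𝒜 : {N n : ℕ} {A : Set} → LabelledGraph n A → ColumnOrder N n → Matrix (Var A) (Fin N)
𝒜 G o x j = ToricMap.φ G (Inverse.to o j) x

-- The vertex set V ∖ {k} is identified with Fin n by punchOut / punchIn at k.
collapseVertex : {n : ℕ} {v₁ k : Fin (suc n)} → k ≢ v₁ → Fin (suc n) → Fin n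
collapseVertex {k = k} k≢v₁ v with k ≟ v
... | yes _   = punchOut k≢v₁
... | no  k≢v = punchOut k≢v

collapsePair : {n : ℕ} {v₁ k : Fin (suc n)} → k ≢ v₁ → Fin (suc n) × Fin (suc n) → Fin n × Fin n
collapsePair k≢v₁ (i , j) = collapseVertex k≢v₁ i , collapseVertex k≢v₁ j

collapsePair-loopless : {n : ℕ} {v₁ k : Fin (suc n)} (k≢v₁ : k ≢ v₁) (i j : Fin (suc n)) →
                        i ≢ j → ¬ ((v₁ , k) ≈ᵘ (i , j)) →
                        collapseVertex k≢v₁ i ≢ collapseVertex k≢v₁ j
collapsePair-loopless {k = k} k≢v₁ i j i≢j ij≢1k eq with k ≟ i | k ≟ j
... | yes refl | yes refl = i≢j refl
... | yes refl | no k≢j   = ij≢1k (inj₂ (punchOut-injective k≢v₁ k≢j eq , refl))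
... | no k≢i   | yes refl = ij≢1k (inj₁ (sym (punchOut-injective k≢i k≢v₁ eq) , refl))
... | no k≢i   | no k≢j   = i≢j (punchOut-injective k≢i k≢j eq)

collapseGraph : {n : ℕ} (G : Graph (suc n)) {v₁ k : Fin (suc n)} →
                k ≢ v₁ → ¬ Graph.Adjacent G v₁ k → Graph n
collapseGraph {n} G k≢v₁ v₁≁k = record
  { edges    = deduplicate (≈ᵘ-dec _≟_) (map (collapsePair k≢v₁) edges)
  ; loopless = All.deduplicate⁺ (≈ᵘ-dec _≟_)
                 (All.map⁺ (All.zipWith (λ { {i , j} (i≢j , ij≢1k) → collapsePair-loopless k≢v₁ i j i≢j ij≢1k })
                                        (loopless , All.¬Any⇒All¬ edges v₁≁k)))
  ; distinct = Unique.deduplicate-! (pairDecSetoid n) (map (collapsePair k≢v₁) edges)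
  }
  where open Graph G

SimpleCollapse : {n : ℕ} (G : Graph (suc n)) {v₁ k : Fin (suc n)} →
                 k ≢ v₁ → ¬ Graph.Adjacent G v₁ k → Set
SimpleCollapse G k≢v₁ v₁≁k = Graph.∣E∣ G ≡ Graph.∣E∣ (collapseGraph G k≢v₁ v₁≁k)

deduplicate-complete : {X : Set} {R : Rel X 0ℓ} (R? : Decidable R) (xs : List X) →
                       length (deduplicate R? xs) ≡ length xs → deduplicate R? xs ≡ xs
deduplicate-complete R? []       eq = refl
deduplicate-complete R? (x ∷ xs) eq = cong (x ∷_) (trans (filter-complete (¬? ∘ R? x) |f|≡|d|) d≡xs)
  where
  d = deduplicate R? xs
  |f|≤|d| = length-filter (¬? ∘ R? x) d
  |f|≡|xs| = suc-injective eq
  |d|≡|xs| : length d ≡ length xs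
  |d|≡|xs| = ≤-antisym (length-deduplicate R? xs) (≤-trans (≤-reflexive (sym |f|≡|xs|)) |f|≤|d|)
  |f|≡|d| : length (filter (¬? ∘ R? x) d) ≡ length d
  |f|≡|d| = trans |f|≡|xs| (sym |d|≡|xs|)
  d≡xs = deduplicate-complete R? xs |d|≡|xs|

lookup-map-cast : {X Y : Set} (f : X → Y) (xs : List X) (ys : List Y) →
                  ys ≡ map f xs → (eq : length xs ≡ length ys) (i : Fin (length xs)) →
                  lookup ys (cast eq i) ≡ f (lookup xs i)
lookup-map-cast f (x ∷ xs) _ refl eq zero    = refl
lookup-map-cast f (x ∷ xs) _ refl eq (suc i) = lookup-map-cast f xs _ refl (suc-injective eq) i

-- In a simple collapse no edge is dropped, so the bijection of edge sets that
-- sends an edge to its image is the one preserving positions.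
cast-collapses : {n : ℕ} (G : Graph (suc n)) {v₁ k : Fin (suc n)} (k≢v₁ : k ≢ v₁) (v₁≁k : ¬ Graph.Adjacent G v₁ k)
                 (simple : SimpleCollapse G k≢v₁ v₁≁k) (e : Graph.Edge G) →
                 Graph.endpoints (collapseGraph G k≢v₁ v₁≁k) (cast simple e) ≡ collapsePair k≢v₁ (Graph.endpoints G e)
cast-collapses G k≢v₁ v₁≁k simple =
  lookup-map-cast (collapsePair k≢v₁) edges _
    (deduplicate-complete (≈ᵘ-dec _≟_) _ (trans (sym simple) (sym (length-map _ edges)))) simple
  where open Graph G

collapse : {n : ℕ} {A : Set} (G : LabelledGraph (suc n) A) {v₁ k : Fin (suc n)}
           (k≢v₁ : k ≢ v₁) (v₁≁k : ¬ LabelledGraph.Adjacent G v₁ k) →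
           SimpleCollapse (LabelledGraph.graph G) k≢v₁ v₁≁k → LabelledGraph n A
collapse G k≢v₁ v₁≁k simple = record
  { graph            = collapseGraph graph k≢v₁ v₁≁k
  ; _≟ᴬ_             = _≟ᴬ_
  ; label            = label ∘ back
  ; label-surjective = λ a → cast simple (proj₁ (label-surjective a)) ,
      λ { refl → proj₂ (label-surjective a) (cast-involutive (sym simple) simple _) }
  ; σ                = σ ∘ back
  ; σ≢0              = σ≢0 ∘ back
  }
  where
  open LabelledGraph G
  back : Graph.Edge (collapseGraph graph k≢v₁ v₁≁k) → Edge
  back = cast (sym simple)

Feasible : {n : ℕ} → Fin n → Fin n → Bipartition n → Set
Feasible v₁ k p = (v₁ ∈ A × k ∈ A) ⊎ (v₁ ∈ B × k ∈ B)
  where open Bipartition p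

zipWith-insertAt : {n : ℕ} (_⊕_ : Bool → Bool → Bool) (P Q : Subset n) (k : Fin (suc n)) {b c d : Bool} →
                   zipWith _⊕_ P Q ≡ replicate n d → b ⊕ c ≡ d →
                   zipWith _⊕_ (insertAt P k b) (insertAt Q k c) ≡ replicate (suc n) d
zipWith-insertAt _⊕_ P       Q       zero    eq refl = cong (_ ∷_) eq
zipWith-insertAt _⊕_ (x ∷ P) (y ∷ Q) (suc k) eq b⊕c =
  cong₂ _∷_ (cong head eq) (zipWith-insertAt _⊕_ P Q k (cong tail eq) b⊕c)

lookup-zipWith-replicate : {n : ℕ} (_⊕_ : Bool → Bool → Bool) (P Q : Subset n) {d : Bool} (i : Fin n) →
                           zipWith _⊕_ P Q ≡ replicate n d → lookupᵛ P i ⊕ lookupᵛ Q i ≡ d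
lookup-zipWith-replicate _⊕_ (x ∷ P) (y ∷ Q) zero    eq = cong head eq
lookup-zipWith-replicate _⊕_ (x ∷ P) (y ∷ Q) (suc i) eq =
  lookup-zipWith-replicate _⊕_ P Q i (cong tail eq)

-- p ↦ p_f: insertAt at k re-embeds V ∖ {k} into V by punchIn k, and k is put
-- in exactly the part containing v₁.
feasible : {n : ℕ} {v₁ k : Fin (suc n)} → k ≢ v₁ → Bipartition n → Bipartition (suc n)
feasible {k = k} k≢v₁ (A ∣ B ⟨ covering , disjoint ⟩) =
  insertAt A k (lookupᵛ A v) ∣ insertAt B k (lookupᵛ B v)
    ⟨ zipWith-insertAt _∨_ A B k covering (lookup-zipWith-replicate _∨_ A B v covering)
    , zipWith-insertAt _∧_ A B k disjoint (lookup-zipWith-replicate _∧_ A B v disjoint) ⟩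
  where v = punchOut k≢v₁

-- The order b of the columns of 𝒜_G presents it as (F , N): the first
-- 2^(n-2) columns are those of p_f, with p in the order o′, and the
-- remaining ones are non-feasible. Here n = 2 + m, and 2 ^ (1 + m) unfolds to
-- 2 ^ m + (2 ^ m + 0).
BlockOrder : {m : ℕ} {v₁ k : Fin (2 + m)} → k ≢ v₁ →
             ColumnOrder (2 ^ (1 + m)) (2 + m) → ColumnOrder (2 ^ m) (1 + m) → Set
BlockOrder {m} {v₁} {k} k≢v₁ b o′ =
  (∀ j → Inverse.to b (j ↑ˡ _) ≈ feasible k≢v₁ (Inverse.to o′ j)) ×
  (∀ j → ¬ Feasible v₁ k (Inverse.to b (2 ^ m ↑ʳ j)))
  where open Setoid (Π (2 + m)) using (_≈_)

identity : {k : ℕ} → Matrix (Fin k) (Fin k)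
identity i j = if does (i ≟ j) then 1ℤ else 0ℤ

zeroMatrix : {R C : Set} → Matrix R C
zeroMatrix _ _ = 0ℤ

stack : {k l : ℕ} {C : Set} → Matrix (Fin k) C → Matrix (Fin l) C → Matrix (Fin (k + l)) C
stack {k} M N i = [ M , N ]′ (splitAt k i)

id-over-0 : (m : ℕ) → Matrix (Fin (2 ^ (1 + m))) (Fin (2 ^ m))
id-over-0 m = stack identity zeroMatrix

-- Row i of M belongs to the i-th partition in the order o; in the result,
-- row i belongs to the i-th partition in the order b.
reorderRows : {N n : ℕ} {C : Set} (o b : ColumnOrder N n) → Matrix (Fin N) C → Matrix (Fin N) C
reorderRows o b M i = M (Inverse.from o (Inverse.to b i))

-- C is a matrix C_{1≡k} for the column orders o of 𝒜_G and o′ of 𝒜_{G_{1≡k}}.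
record IsCollapseMatrix {m : ℕ} {A : Set} (G : LabelledGraph (2 + m) A) {v₁ k : Fin (2 + m)}
  (k≢v₁ : k ≢ v₁) (v₁≁k : ¬ LabelledGraph.Adjacent G v₁ k)
  (simple : SimpleCollapse (LabelledGraph.graph G) k≢v₁ v₁≁k)
  (o : ColumnOrder (2 ^ (1 + m)) (2 + m)) (o′ : ColumnOrder (2 ^ m) (1 + m))
  (C : Matrix (Fin (2 ^ (1 + m))) (Fin (2 ^ m))) : Set where
  field
    product   : 𝒜 G o ⊗ C ≈ᴹ 𝒜 (collapse G k≢v₁ v₁≁k simple) o′
    blockForm : ∀ b → BlockOrder k≢v₁ b o′ → reorderRows o b C ≈ᴹ id-over-0 m

{-# OPTIONS --safe #-}

-- A cut of G along p_f is a cut of the collapsed graph along p, edge by edge, so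
-- the column of p in 𝒜_{G_{1≡k}} is the column of p_f in 𝒜_G. In a block order
-- this says that 𝒜_G times (id over 0) is 𝒜_{G_{1≡k}}, and the block form leaves
-- no other choice of matrix. For other column orders the rows of (id over 0) get
-- permuted; all permutations occur, so the matrices C_{1≡k} are exactly the
-- finitely many row permutations of (id over 0).
module Submission where

open import Defs
open import Data.Bool.Base using (Bool; true; false; not; _∧_; _∨_; _xor_)
open import Data.Fin.Base using (Fin; zero; suc; cast; combine; punchIn; punchOut; remQuot; splitAt; _↑ˡ_; _↑ʳ_)
open import Data.Fin.Permutation using (Permutation′; _⟨$⟩ʳ_; insert; remove; insert-remove)
import Data.Fin.Permutation as Perm
open import Data.Fin.Properties using (_≟_; 2↔Bool; cast-involutive; cast-is-id; combine-remQuot; combine-surjective; punchIn-punchOut; punchInᵢ≢i; remQuot-combine; splitAt-↑ˡ; splitAt⁻¹-↑ˡ; splitAt⁻¹-↑ʳ)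
open import Data.Fin.Subset using (Subset; _∈_)
open import Data.Integer.Base using (ℤ; 0ℤ; 1ℤ) renaming (_+_ to _+ℤ_; _*_ to _*ℤ_)
open import Data.Integer.Properties using (+-0-commutativeMonoid; *-zeroʳ; *-identityʳ) renaming (+-identityʳ to +ℤ-identityʳ)
open import Data.List.Base using (List; []; _∷_; allFin; cartesianProductWith; filter; map)
open import Data.List.Membership.Propositional.Properties using (∈-allFin)
open import Data.List.Properties using (map-cong; map-id)
open import Data.List.Relation.Unary.Any using (Any; here)
import Data.List.Relation.Unary.Any as Any
open import Data.List.Relation.Unary.Any.Properties using (cartesianProductWith⁺; map⁺; map⁻)
open import Data.Nat.Base using (ℕ; zero; suc; _+_; _^_)
open import Data.Product.Base using (_×_; _,_; ∃; ∃₂; proj₁; proj₂)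
open import Data.Sum.Base using (_⊎_; inj₁; inj₂)
import Data.Sum.Base as Sum
open import Data.Vec.Base using ([]; _∷_; insertAt; lookup; removeAt; replicate; zipWith; head; tail)
open import Data.Vec.Properties using (insertAt-lookup; insertAt-punchIn; insertAt-removeAt; lookup⇒[]=; []=⇒lookup; removeAt-insertAt; removeAt-punchOut)
open import Function.Base using (_∘_)
open import Function.Bundles using (_⇔_; mk⇔; Equivalence; Inverse)
import Function.Construct.Composition as Composition
import Function.Construct.Symmetry as Symmetry
open import Level using (0ℓ)
open import Relation.Binary.Bundles using (Setoid)
open import Relation.Binary.PropositionalEquality using (_≡_; _≢_; refl; sym; trans; cong; cong₂; subst; module ≡-Reasoning)
open import Relation.Binary.Structures using (IsEquivalence)
open import Relation.Nullary using (¬_; yes; no; contradiction)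
open import Relation.Nullary.Decidable using (¬?)
import Relation.Unary as U

open import Algebra.Properties.CommutativeMonoid.Sum +-0-commutativeMonoid using (sum; sum-remove; sum-cong-≗; sum-replicate-zero)

open Inverse using (to; from; to-cong; from-cong; inverseˡ; inverseʳ; strictlyInverseˡ; strictlyInverseʳ)

-- Unordered bipartitions and the bit that tells whether two vertices are separated.

module _ {n : ℕ} where
  open Setoid (Π n) public using () renaming (_≈_ to _≈ᴾ_)

  -- Taken on pairs of subsets, so that unification need not recover covering and disjoint.
  open IsEquivalence (≈ᵘ-isEquivalence {Subset n}) public using () renaming (refl to ≈ᴾ-refl; sym to ≈ᴾ-sym; trans to ≈ᴾ-trans)

xor-cancel : ∀ a c → a xor (c xor a) ≡ c
xor-cancel true  true  = refl
xor-cancel true  false = refl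
xor-cancel false true  = refl
xor-cancel false false = refl

xor-cancelʳ : ∀ a b → (a xor b) xor a ≡ b
xor-cancelʳ true  true  = refl
xor-cancelʳ true  false = refl
xor-cancelʳ false true  = refl
xor-cancelʳ false false = refl

not-xor-not : ∀ a b → not a xor not b ≡ a xor b
not-xor-not true  true  = refl
not-xor-not true  false = refl
not-xor-not false true  = refl
not-xor-not false false = refl

complement-unique : ∀ a b → a ∨ b ≡ true → a ∧ b ≡ false → b ≡ not a
complement-unique true  false _ _ = refl
complement-unique false true  _ _ = refl

xor-∨-complement : ∀ c a → (c xor a) ∨ (c xor not a) ≡ true
xor-∨-complement true  true  = refl
xor-∨-complement true  false = refl
xor-∨-complement false true  = refl
xor-∨-complement false false = refl

xor-∧-complement : ∀ c a → (c xor a) ∧ (c xor not a) ≡ false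
xor-∧-complement true  true  = refl
xor-∧-complement true  false = refl
xor-∧-complement false true  = refl
xor-∧-complement false false = refl

zipWith-removeAt : {n : ℕ} (_⊕_ : Bool → Bool → Bool) (P Q : Subset (suc n)) (k : Fin (suc n)) {d : Bool} →
                   zipWith _⊕_ P Q ≡ replicate (suc n) d →
                   zipWith _⊕_ (removeAt P k) (removeAt Q k) ≡ replicate n d
zipWith-removeAt _⊕_ (x ∷ P)         (y ∷ Q)         zero    eq = cong tail eq
zipWith-removeAt _⊕_ (x ∷ P@(_ ∷ _)) (y ∷ Q@(_ ∷ _)) (suc k) eq =
  cong₂ _∷_ (cong head eq) (zipWith-removeAt _⊕_ P Q k (cong tail eq))

lookup-B : {n : ℕ} (p : Bipartition n) (i : Fin n) →
           lookup (Bipartition.B p) i ≡ not (lookup (Bipartition.A p) i)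
lookup-B (A ∣ B ⟨ covering , disjoint ⟩) i =
  complement-unique _ _ (lookup-zipWith-replicate _∨_ A B i covering)
                        (lookup-zipWith-replicate _∧_ A B i disjoint)

-- Feasibility recast as a bit, `false` exactly on the partitions feasible for `i` and `j`.
-- Exchanging the two parts negates both lookups and leaves their `xor` unchanged, so the bit is
-- well defined on unordered pairs.
separates : {n : ℕ} → Fin n → Fin n → Bipartition n → Bool
separates i j p = lookup A i xor lookup A j
  where open Bipartition p

separates-cong : {n : ℕ} (i j : Fin n) {p q : Bipartition n} → p ≈ᴾ q → separates i j p ≡ separates i j q
separates-cong i j (inj₁ (A≡A′ , _)) = cong (λ P → lookup P i xor lookup P j) A≡A′
separates-cong i j {p} {q} (inj₂ (A≡B′ , _)) = begin
  lookup (A p) i xor lookup (A p) j              ≡⟨ cong (λ P → lookup P i xor lookup P j) A≡B′ ⟩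
  lookup (B q) i xor lookup (B q) j              ≡⟨ cong₂ _xor_ (lookup-B q i) (lookup-B q j) ⟩
  not (lookup (A q) i) xor not (lookup (A q) j)  ≡⟨ not-xor-not (lookup (A q) i) _ ⟩
  lookup (A q) i xor lookup (A q) j              ∎
  where open ≡-Reasoning; open Bipartition

feasible⇒¬separates : {n : ℕ} {i j : Fin n} (p : Bipartition n) → Feasible i j p → separates i j p ≡ false
feasible⇒¬separates p (inj₁ (i∈A , j∈A)) = cong₂ _xor_ ([]=⇒lookup i∈A) ([]=⇒lookup j∈A)
feasible⇒¬separates {i = i} {j} p (inj₂ (i∈B , j∈B)) =
  trans (sym (not-xor-not (lookup A i) (lookup A j))) (cong₂ _xor_ (outside-A i∈B) (outside-A j∈B))
  where
  open Bipartition p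
  outside-A : ∀ {v} → v ∈ B → not (lookup A v) ≡ true
  outside-A {v} v∈B = trans (sym (lookup-B p v)) ([]=⇒lookup v∈B)

¬separates⇒feasible : {n : ℕ} (i j : Fin n) (p : Bipartition n) → separates i j p ≡ false → Feasible i j p
¬separates⇒feasible i j p sep with lookup (Bipartition.A p) i in i-eq | lookup (Bipartition.A p) j in j-eq
¬separates⇒feasible i j p ()  | true  | false
... | true  | true  = inj₁ (lookup⇒[]= i _ i-eq , lookup⇒[]= j _ j-eq)
... | false | false = inj₂ (lookup⇒[]= i _ (trans (lookup-B p i) (cong not i-eq)) ,
                            lookup⇒[]= j _ (trans (lookup-B p j) (cong not j-eq)))

-- Deleting the vertex `k` from a partition and putting it back.

restrict : {n : ℕ} → Fin (suc n) → Bipartition (suc n) → Bipartition n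
restrict k (A ∣ B ⟨ covering , disjoint ⟩) =
  removeAt A k ∣ removeAt B k
    ⟨ zipWith-removeAt _∨_ A B k covering , zipWith-removeAt _∧_ A B k disjoint ⟩

restrict-cong : {n : ℕ} (k : Fin (suc n)) {p q : Bipartition (suc n)} → p ≈ᴾ q → restrict k p ≈ᴾ restrict k q
restrict-cong k = Sum.map (λ (a , b) → cong (λ P → removeAt P k) a , cong (λ P → removeAt P k) b)
                          (λ (a , b) → cong (λ P → removeAt P k) a , cong (λ P → removeAt P k) b)

module _ {n : ℕ} {v₁ k : Fin (suc n)} (k≢v₁ : k ≢ v₁) where

  private v = punchOut k≢v₁

  -- extend false p has the parts of p_f; extend true p has k moved to the other part.
  extend : Bool → Bipartition n → Bipartition (suc n)
  extend c p@(A ∣ B ⟨ covering , disjoint ⟩) =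
    insertAt A k (c xor lookup A v) ∣ insertAt B k (c xor lookup B v)
      ⟨ zipWith-insertAt _∨_ A B k covering
          (trans (cong (λ b → (c xor lookup A v) ∨ (c xor b)) (lookup-B p v)) (xor-∨-complement c (lookup A v)))
      , zipWith-insertAt _∧_ A B k disjoint
          (trans (cong (λ b → (c xor lookup A v) ∧ (c xor b)) (lookup-B p v)) (xor-∧-complement c (lookup A v))) ⟩

  extend-cong : ∀ c {p q} → p ≈ᴾ q → extend c p ≈ᴾ extend c q
  extend-cong c = Sum.map (λ (a , b) → cong ext a , cong ext b) (λ (a , b) → cong ext a , cong ext b)
    where
    ext : Subset n → Subset (suc n)
    ext P = insertAt P k (c xor lookup P v)

  restrict-extend : ∀ c p → restrict k (extend c p) ≈ᴾ p
  restrict-extend c p = inj₁ (removeAt-insertAt A k _ , removeAt-insertAt B k _)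
    where open Bipartition p

  lookup-insertAt-v₁ : ∀ (P : Subset n) b → lookup (insertAt P k b) v₁ ≡ lookup P v
  lookup-insertAt-v₁ P b =
    trans (cong (lookup (insertAt P k b)) (sym (punchIn-punchOut k≢v₁))) (insertAt-punchIn P k b v)

  separates-extend : ∀ c p → separates v₁ k (extend c p) ≡ c
  separates-extend c p = begin
    lookup (insertAt A k a) v₁ xor lookup (insertAt A k a) k  ≡⟨ cong₂ _xor_ (lookup-insertAt-v₁ A a) (insertAt-lookup A k a) ⟩
    lookup A v xor (c xor lookup A v)                         ≡⟨ xor-cancel (lookup A v) c ⟩
    c                                                         ∎
    where
    open ≡-Reasoning
    open Bipartition p
    a = c xor lookup A v

  -- The side of `k` is the side of `v₁` corrected by the separating bit, so `xor` recovers it.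
  -- Together with `restrict-extend` and `separates-extend` this identifies `Π (suc n)` with pairs
  -- of a bit and an element of `Π n`.
  extend-restrict : ∀ p → extend (separates v₁ k p) (restrict k p) ≈ᴾ p
  extend-restrict p = inj₁ (reinsert A refl , reinsert B sep-B)
    where
    open Bipartition p
    -- The bit is read off `A` but must also rebuild `B`; as `B` is the complement of `A`, the two
    -- negations cancel.
    sep-B : separates v₁ k p ≡ lookup B v₁ xor lookup B k
    sep-B = trans (sym (not-xor-not (lookup A v₁) _)) (sym (cong₂ _xor_ (lookup-B p v₁) (lookup-B p k)))

    reinsert : ∀ P {c} → c ≡ lookup P v₁ xor lookup P k →
               insertAt (removeAt P k) k (c xor lookup (removeAt P k) v) ≡ P
    reinsert P refl = trans
      (cong (insertAt (removeAt P k) k)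
        (trans (cong ((lookup P v₁ xor lookup P k) xor_) (removeAt-punchOut P k≢v₁))
               (xor-cancelʳ (lookup P v₁) (lookup P k))))
      (insertAt-removeAt P k)

  -- A part of p_f is the preimage of a part of p under the collapse: `k` is sent to the image of
  -- `v₁`, and every other vertex to its own copy. This is the geometric core of the comparison of
  -- cuts.
  feasible-collapse : ∀ (P : Subset n) i → lookup (insertAt P k (lookup P v)) i ≡ lookup P (collapseVertex k≢v₁ i)
  feasible-collapse P i with k ≟ i
  ... | yes refl = insertAt-lookup P k _
  ... | no k≢i   = trans (cong (lookup (insertAt P k _)) (sym (punchIn-punchOut k≢i))) (insertAt-punchIn P k _ _)

  feasible-isFeasible : ∀ p → Feasible v₁ k (feasible k≢v₁ p)
  -- `false xor b` computes to `b`, so `feasible` and `extend false` have the same parts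
  -- definitionally.
  feasible-isFeasible p = ¬separates⇒feasible v₁ k (feasible k≢v₁ p) (separates-extend false p)

Feasible-resp : {n : ℕ} {i j : Fin n} (p q : Bipartition n) → p ≈ᴾ q → Feasible i j p → Feasible i j q
Feasible-resp {i = i} {j} p q p≈q feas =
  ¬separates⇒feasible i j q (trans (sym (separates-cong i j {p} {q} p≈q)) (feasible⇒¬separates p feas))

-- Existence of block orders and of column orders.

place : {m : ℕ} {v₁ k : Fin (2 + m)} → k ≢ v₁ → ColumnOrder (2 ^ m) (1 + m) →
        Fin 2 × Fin (2 ^ m) → Bipartition (2 + m)
place k≢v₁ o′ (c , j) = extend k≢v₁ (to 2↔Bool c) (to o′ j)

-- The index combine c j of 2 ^ (1 + m) is j in the left (c = 0) or right (c = 1) block.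
blockOrder : {m : ℕ} {v₁ k : Fin (2 + m)} → k ≢ v₁ → ColumnOrder (2 ^ m) (1 + m) → ColumnOrder (2 ^ (1 + m)) (2 + m)
blockOrder {m} {v₁} {k} k≢v₁ o′ = record
  { to        = toᵇ
  ; from      = fromᵇ
  ; to-cong   = λ { refl → ≈ᴾ-refl }
  ; from-cong = λ {p} {q} → fromᵇ-cong {p} {q}
  ; inverse   = (λ {p} {i} → λ { refl → to∘from p })
              , (λ {i} {p} p≈ → trans (fromᵇ-cong {p} {toᵇ i} p≈) (from∘to i))
  }
  where
  bit = to 2↔Bool
  bit⁻¹ = from 2↔Bool

  toᵇ : Fin (2 ^ (1 + m)) → Bipartition (2 + m)
  toᵇ i = place k≢v₁ o′ (remQuot (2 ^ m) i)

  fromᵇ : Bipartition (2 + m) → Fin (2 ^ (1 + m))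
  fromᵇ p = combine (bit⁻¹ (separates v₁ k p)) (from o′ (restrict k p))

  fromᵇ-cong : ∀ {p q} → p ≈ᴾ q → fromᵇ p ≡ fromᵇ q
  fromᵇ-cong {p} {q} p≈q =
    cong₂ combine (cong bit⁻¹ (separates-cong v₁ k {p} {q} p≈q)) (from-cong o′ (restrict-cong k {p} {q} p≈q))

  to∘from : ∀ p → toᵇ (fromᵇ p) ≈ᴾ p
  to∘from p = subst (_≈ᴾ p) (sym to-combine)
    (≈ᴾ-trans (extend-cong k≢v₁ sep {to o′ (from o′ (restrict k p))} {restrict k p}
                (strictlyInverseˡ o′ (restrict k p)))
              (extend-restrict k≢v₁ p))
    where
    sep = separates v₁ k p
    to-combine : toᵇ (fromᵇ p) ≡ extend k≢v₁ sep (to o′ (from o′ (restrict k p)))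
    to-combine = trans (cong (place k≢v₁ o′) (remQuot-combine (bit⁻¹ sep) (from o′ (restrict k p))))
                       (cong (λ c → extend k≢v₁ c (to o′ (from o′ (restrict k p)))) (strictlyInverseˡ 2↔Bool sep))

  from∘place : ∀ c j → fromᵇ (place k≢v₁ o′ (c , j)) ≡ combine c j
  from∘place c j = cong₂ combine
    (trans (cong bit⁻¹ (separates-extend k≢v₁ (bit c) (to o′ j))) (strictlyInverseʳ 2↔Bool c))
    (inverseʳ o′ (restrict-extend k≢v₁ (bit c) (to o′ j)))

  from∘to : ∀ i → fromᵇ (toᵇ i) ≡ i
  from∘to i = trans (from∘place _ _) (combine-remQuot {2} (2 ^ m) i)

blockOrder-isBlockOrder : {m : ℕ} {v₁ k : Fin (2 + m)} (k≢v₁ : k ≢ v₁) (o′ : ColumnOrder (2 ^ m) (1 + m)) →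
                          BlockOrder k≢v₁ (blockOrder k≢v₁ o′) o′
blockOrder-isBlockOrder {m} {v₁} {k} k≢v₁ o′ = left , right
  where
  b = blockOrder k≢v₁ o′

  to-combine : ∀ c j → to b (combine c j) ≡ place k≢v₁ o′ (c , j)
  to-combine c j = cong (place k≢v₁ o′) (remQuot-combine c j)

  left : ∀ j → to b (j ↑ˡ _) ≈ᴾ feasible k≢v₁ (to o′ j)
  -- The index `j ↑ˡ _` is `combine zero j`, and `2↔Bool` sends `zero` to `false`, so the partition
  -- placed there has the parts of p_f.
  left j = subst (_≈ᴾ feasible k≢v₁ (to o′ j)) (sym (to-combine zero j)) (inj₁ (refl , refl))

  right′ : ∀ c j → ¬ Feasible v₁ k (to b (combine (suc c) j))
  right′ zero j feas
    with () ← trans (sym (separates-extend k≢v₁ true (to o′ j)))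
                    (feasible⇒¬separates (place k≢v₁ o′ (suc zero , j)) (subst (Feasible v₁ k) (to-combine (suc zero) j) feas))

  right : ∀ j → ¬ Feasible v₁ k (to b (2 ^ m ↑ʳ j))
  right j feas with combine-surjective {1} {2 ^ m} j
  -- The right block has `2 ^ m + 0`, that is `1 * 2 ^ m`, indices, so `j` is `combine c j′` with
  -- `c` in `Fin 1`; the shift by `2 ^ m` turns the leading digit into `suc c`.
  ... | c , j′ , refl = right′ c j′ feas

-- Guarantees that some order of the columns exists, so that every listed matrix is attained. The
-- induction adds one vertex at a time: `blockOrder` speaks only of vertices and partitions, so it
-- doubles an order here as well, with `zero` as the new vertex and `suc zero` as its reference.
columnOrder : ∀ m → ColumnOrder (2 ^ m) (1 + m)
columnOrder zero = record
  { to        = λ _ → p₀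
  ; from      = λ _ → zero
  ; to-cong   = λ _ → ≈ᴾ-refl
  ; from-cong = λ _ → refl
  ; inverse   = (λ {p} _ → p₀≈ p) , λ { {zero} _ → refl }
  }
  where
  p₀ : Bipartition 1
  p₀ = (true ∷ []) ∣ (false ∷ []) ⟨ refl , refl ⟩

  p₀≈ : ∀ p → p₀ ≈ᴾ p
  p₀≈ ((true ∷ [])  ∣ (false ∷ []) ⟨ _ , _ ⟩) = inj₁ (refl , refl)
  p₀≈ ((false ∷ []) ∣ (true ∷ [])  ⟨ _ , _ ⟩) = inj₂ (refl , refl)
  p₀≈ ((true ∷ [])  ∣ (true ∷ [])  ⟨ _ , () ⟩)
  p₀≈ ((false ∷ []) ∣ (false ∷ []) ⟨ () , _ ⟩)
columnOrder (suc m) = blockOrder {v₁ = suc zero} {k = zero} (λ ()) (columnOrder m)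

-- Cuts and their monomials under the collapse.

-- Compares the exponents of a single variable `x`, which keeps the equality of monomials pointwise.
-- Since `P` and `Q` agree along `h`, both filters keep or drop the same edge at each position.
∏-filter-map : {n n′ : ℕ} {A : Set} (G : LabelledGraph n A) (G′ : LabelledGraph n′ A)
               (h : LabelledGraph.Edge G → LabelledGraph.Edge G′)
               {P : U.Pred (LabelledGraph.Edge G) 0ℓ} {Q : U.Pred (LabelledGraph.Edge G′) 0ℓ}
               (P? : U.Decidable P) (Q? : U.Decidable Q) (P⇔Q : ∀ e → P e ⇔ Q (h e))
               (f : LabelledGraph.Edge G → Monomial A) (g : LabelledGraph.Edge G′ → Monomial A) (x : Var A)
               (f≡g : ∀ e → f e x ≡ g (h e) x) (es : List (LabelledGraph.Edge G)) →
               ToricMap.∏ G (filter P? es) f x ≡ ToricMap.∏ G′ (filter Q? (map h es)) g x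
∏-filter-map G G′ h P? Q? P⇔Q f g x f≡g []       = refl
∏-filter-map G G′ h P? Q? P⇔Q f g x f≡g (e ∷ es) with P? e | Q? (h e)
... | yes _ | yes _ = cong₂ _+ℤ_ (f≡g e) (∏-filter-map G G′ h P? Q? P⇔Q f g x f≡g es)
... | no _  | no _  = ∏-filter-map G G′ h P? Q? P⇔Q f g x f≡g es
... | yes p | no ¬q = contradiction (Equivalence.to (P⇔Q e) p) ¬q
... | no ¬p | yes q = contradiction (Equivalence.from (P⇔Q e) q) ¬p

map-cast-allFin : {n n′ : ℕ} (eq : n ≡ n′) → map (cast eq) (allFin n) ≡ allFin n′
map-cast-allFin refl = trans (map-cong (cast-is-id refl) _) (map-id _)

-- `InCut` as a predicate on a pair of vertices instead of an edge position: `InCut p e` unfolds to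
-- it at `endpoints e`, and it can be carried along the equation `cast-collapses`.
Splits : {n : ℕ} → Bipartition n → Fin n × Fin n → Set
Splits p (i , j) = (i ∈ A × j ∈ B) ⊎ (i ∈ B × j ∈ A)
  where open Bipartition p

Splits-resp : {n : ℕ} (p q : Bipartition n) → p ≈ᴾ q → ∀ e → Splits p e → Splits q e
Splits-resp (_ ∣ _ ⟨ _ , _ ⟩) (_ ∣ _ ⟨ _ , _ ⟩) (inj₁ (refl , refl)) e = Sum.map (λ x → x) (λ x → x)
Splits-resp (_ ∣ _ ⟨ _ , _ ⟩) (_ ∣ _ ⟨ _ , _ ⟩) (inj₂ (refl , refl)) e = Sum.swap

module _ {n : ℕ} {v₁ k : Fin (suc n)} (k≢v₁ : k ≢ v₁) where

  private
    fᵖ : Subset n → Subset (suc n)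
    fᵖ P = insertAt P k (lookup P (punchOut k≢v₁))

    down : ∀ P {i} → i ∈ fᵖ P → collapseVertex k≢v₁ i ∈ P
    down P {i} i∈ = lookup⇒[]= _ P (trans (sym (feasible-collapse k≢v₁ P i)) ([]=⇒lookup i∈))

    up : ∀ P {i} → collapseVertex k≢v₁ i ∈ P → i ∈ fᵖ P
    up P {i} i∈ = lookup⇒[]= i _ (trans (feasible-collapse k≢v₁ P i) ([]=⇒lookup i∈))

  Splits-feasible : ∀ p e → Splits (feasible k≢v₁ p) e ⇔ Splits p (collapsePair k≢v₁ e)
  Splits-feasible (A ∣ B ⟨ _ , _ ⟩) e = mk⇔
    (Sum.map (λ (a , b) → down A a , down B b) (λ (b , a) → down B b , down A a))
    (Sum.map (λ (a , b) → up A a , up B b)     (λ (b , a) → up B b , up A a))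

module _ {n : ℕ} {A : Set} (G : LabelledGraph (suc n) A) {v₁ k : Fin (suc n)}
         (k≢v₁ : k ≢ v₁) (v₁≁k : ¬ LabelledGraph.Adjacent G v₁ k)
         (simple : SimpleCollapse (LabelledGraph.graph G) k≢v₁ v₁≁k) where

  private
    open LabelledGraph G using (graph; Edge; endpoints; label; σ; ∣E∣)
    G′ = collapse G k≢v₁ v₁≁k simple
    module T  = ToricMap G
    module T′ = ToricMap G′

  -- Stated for any `q` equivalent to p_f because a column order may list p_f with its two parts
  -- exchanged; a cut does not see the exchange.
  inCut-collapse : ∀ q p → q ≈ᴾ feasible k≢v₁ p → ∀ e → T.InCut q e ⇔ T′.InCut p (cast simple e)
  inCut-collapse q p q≈pf e = mk⇔
    (λ c → subst (Splits p) (sym ends) (Equivalence.to ⇔pf (Splits-resp q pf q≈pf (endpoints e) c)))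
    (λ c → Splits-resp pf q (≈ᴾ-sym q≈pf) (endpoints e) (Equivalence.from ⇔pf (subst (Splits p) ends c)))
    where
    pf = feasible k≢v₁ p
    ends = cast-collapses graph k≢v₁ v₁≁k simple e
    ⇔pf = Splits-feasible k≢v₁ p (endpoints e)

  φ-collapse : ∀ q p → q ≈ᴾ feasible k≢v₁ p → ∀ x → T.φ q x ≡ T′.φ p x
  φ-collapse q p q≈pf x = cong₂ _+ℤ_
    (transport s (T.inCut? q) (T′.inCut? p) cut)
    (transport t (¬? ∘ T.inCut? q) (¬? ∘ T′.inCut? p)
      (λ e → mk⇔ (_∘ Equivalence.from (cut e)) (_∘ Equivalence.to (cut e))))
    where
    cut = inCut-collapse q p q≈pf

    module _ (var : A → Var A) where
      f : Edge → Monomial A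
      f e = var (label e) T.^^ σ e

      f′ : LabelledGraph.Edge G′ → Monomial A
      f′ e = var (LabelledGraph.label G′ e) T′.^^ LabelledGraph.σ G′ e

      transport : {P : U.Pred Edge 0ℓ} {Q : U.Pred (LabelledGraph.Edge G′) 0ℓ}
                  (P? : U.Decidable P) (Q? : U.Decidable Q) → (∀ e → P e ⇔ Q (cast simple e)) →
                  T.∏ (filter P? (allFin _)) f x ≡ T′.∏ (filter Q? (allFin _)) f′ x
      transport P? Q? P⇔Q = trans
        (∏-filter-map G G′ (cast simple) P? Q? P⇔Q f f′ x
          -- Labels and multiplicities of the collapse are read through the inverse cast, so at
          -- `cast simple e` the two casts cancel.
          (λ e → cong (λ e → f e x) (sym (cast-involutive (sym simple) simple e)))
          (allFin ∣E∣))
        (cong (λ es → T′.∏ (filter Q? es) f′ x) (map-cast-allFin simple))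

-- The matrix product and the block form.

sum-single : {n : ℕ} (f : Fin n → ℤ) (i : Fin n) → (∀ h → h ≢ i → f h ≡ 0ℤ) → sum f ≡ f i
sum-single {suc n} f i f≡0 = begin
  sum f                          ≡⟨ sum-remove {i = i} f ⟩
  f i +ℤ sum (f ∘ punchIn i)     ≡⟨ cong (f i +ℤ_) (sum-cong-≗ (λ h → f≡0 _ (punchInᵢ≢i i h))) ⟩
  f i +ℤ sum {n} (λ _ → 0ℤ)      ≡⟨ cong (f i +ℤ_) (sum-replicate-zero n) ⟩
  f i +ℤ 0ℤ                      ≡⟨ +ℤ-identityʳ (f i) ⟩
  f i                            ∎
  where open ≡-Reasoning

identity-diagonal : {n : ℕ} (j : Fin n) → identity j j ≡ 1ℤ
identity-diagonal j with j ≟ j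
... | yes _  = refl
... | no j≢j = contradiction refl j≢j

id-over-0-diagonal : ∀ m j → id-over-0 m (j ↑ˡ _) j ≡ 1ℤ
id-over-0-diagonal m j rewrite splitAt-↑ˡ (2 ^ m) j (2 ^ m + 0) = identity-diagonal j

id-over-0-off-diagonal : ∀ m i j → i ≢ j ↑ˡ _ → id-over-0 m i j ≡ 0ℤ
id-over-0-off-diagonal m i j i≢j with splitAt (2 ^ m) i in eq
... | inj₂ _ = refl
... | inj₁ i′ with i′ ≟ j
...   | yes refl = contradiction (sym (splitAt⁻¹-↑ˡ eq)) i≢j
...   | no _     = refl

module _ {m : ℕ} {A : Set} (G : LabelledGraph (2 + m) A) {v₁ k : Fin (2 + m)}
         (k≢v₁ : k ≢ v₁) (v₁≁k : ¬ LabelledGraph.Adjacent G v₁ k)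
         (simple : SimpleCollapse (LabelledGraph.graph G) k≢v₁ v₁≁k)
         (o b : ColumnOrder (2 ^ (1 + m)) (2 + m)) (o′ : ColumnOrder (2 ^ m) (1 + m))
         (isBlock : BlockOrder k≢v₁ b o′)
         (C : Matrix (Fin (2 ^ (1 + m))) (Fin (2 ^ m))) where

  private
    G′ = collapse G k≢v₁ v₁≁k simple

  -- Column `j` of the reordered matrix has a single 1, in the row of p_f, so the product selects
  -- the column of p_f, which `φ-collapse` identifies with that of p. The block form has to hold for
  -- every block order, and any two of them differ only in the rows where the matrix vanishes.
  ≈⇒isCollapseMatrix : C ≈ᴹ reorderRows b o (id-over-0 m) → IsCollapseMatrix G k≢v₁ v₁≁k simple o o′ C
  ≈⇒isCollapseMatrix C≈ = record { product = product ; blockForm = blockForm }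
    where
    open ≡-Reasoning

    product : 𝒜 G o ⊗ C ≈ᴹ 𝒜 G′ o′
    product x j = begin
      sum (λ h → 𝒜 G o x h *ℤ C h j)  ≡⟨ sum-single _ h₀ off ⟩
      𝒜 G o x h₀ *ℤ C h₀ j            ≡⟨ cong (𝒜 G o x h₀ *ℤ_) C-h₀ ⟩
      𝒜 G o x h₀ *ℤ 1ℤ                ≡⟨ *-identityʳ _ ⟩
      𝒜 G o x h₀                      ≡⟨ φ-collapse G k≢v₁ v₁≁k simple (to o h₀) (to o′ j) column-h₀ x ⟩
      𝒜 G′ o′ x j                     ∎
      where
      -- The position in the order `o` of the partition p_f, where p is the `j`-th partition in
      -- `o′`.
      h₀ = from o (to b (j ↑ˡ _))

      column-h₀ : to o h₀ ≈ᴾ feasible k≢v₁ (to o′ j)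
      column-h₀ = ≈ᴾ-trans (strictlyInverseˡ o _) (proj₁ isBlock j)

      C-h₀ : C h₀ j ≡ 1ℤ
      C-h₀ = trans (C≈ h₀ j) (trans (cong (λ i → id-over-0 m i j) (inverseʳ b (strictlyInverseˡ o _)))
                                    (id-over-0-diagonal m j))

      off : ∀ h → h ≢ h₀ → 𝒜 G o x h *ℤ C h j ≡ 0ℤ
      off h h≢h₀ = trans (cong (𝒜 G o x h *ℤ_) (trans (C≈ h j) (id-over-0-off-diagonal m _ j
                     (λ eq → h≢h₀ (sym (inverseʳ o (inverseˡ b (sym eq))))))))
                   (*-zeroʳ (𝒜 G o x h))

    blockForm : ∀ b′ → BlockOrder k≢v₁ b′ o′ → reorderRows o b′ C ≈ᴹ id-over-0 m
    blockForm b′ isBlock′ i j = begin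
      C (from o (to b′ i)) j                                 ≡⟨ C≈ _ j ⟩
      id-over-0 m (from b (to o (from o (to b′ i)))) j       ≡⟨ cong (λ i → id-over-0 m i j) (from-cong b (strictlyInverseˡ o (to b′ i))) ⟩
      id-over-0 m (from b (to b′ i)) j                       ≡⟨ same-block (splitAt (2 ^ m) i) refl ⟩
      id-over-0 m i j                                        ∎
      where
      same-block : ∀ side → splitAt (2 ^ m) i ≡ side → id-over-0 m (from b (to b′ i)) j ≡ id-over-0 m i j
      -- In the left block both orders list the same p_f at `i′`.
      same-block (inj₁ i′) eq with refl ← splitAt⁻¹-↑ˡ {2 ^ m} eq =
        cong (λ i → id-over-0 m i j)
          (inverseʳ b (≈ᴾ-trans (proj₁ isBlock′ i′) (≈ᴾ-sym (proj₁ isBlock i′))))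
      -- In the right block `b` and `b′` may disagree, but both entries are 0: a diagonal position
      -- for either index would make a non-feasible partition equivalent to p_f.
      same-block (inj₂ i′) eq with refl ← splitAt⁻¹-↑ʳ {2 ^ m} eq = trans
        (id-over-0-off-diagonal m _ j (λ eq′ → infeasible
          (≈ᴾ-trans (≈ᴾ-sym (inverseˡ b (sym eq′))) (proj₁ isBlock j))))
        (sym (id-over-0-off-diagonal m _ j (λ eq′ → infeasible
          (≈ᴾ-trans (to-cong b′ eq′) (proj₁ isBlock′ j)))))
        where
        infeasible : ¬ (to b′ (2 ^ m ↑ʳ i′) ≈ᴾ feasible k≢v₁ (to o′ j))
        infeasible ≈pf = proj₂ isBlock′ i′
          (Feasible-resp (feasible k≢v₁ (to o′ j)) (to b′ (2 ^ m ↑ʳ i′)) (≈ᴾ-sym ≈pf) (feasible-isFeasible k≢v₁ (to o′ j)))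

  -- The block form at `b` determines every row: row `h` of `C` is the one that `reorderRows o b`
  -- moves to position `from b (to o h)`.
  isCollapseMatrix⇒≈ : IsCollapseMatrix G k≢v₁ v₁≁k simple o o′ C → C ≈ᴹ reorderRows b o (id-over-0 m)
  isCollapseMatrix⇒≈ isC h j = trans
    (cong (λ h → C h j) (sym (inverseʳ o (strictlyInverseˡ b (to o h)))))
    (IsCollapseMatrix.blockForm isC b isBlock (from b (to o h)) j)

-- Enumeration of permutations and the list of collapse matrices.

permutations : ∀ n → List (Permutation′ n)
permutations zero    = Perm.id ∷ []
permutations (suc n) = cartesianProductWith (insert zero) (allFin (suc n)) (permutations n)

insert-cong : {n : ℕ} (i : Fin (suc n)) {j j′ : Fin (suc n)} {π ρ : Permutation′ n} →
              j ≡ j′ → π Perm.≈ ρ → insert i j π Perm.≈ insert i j′ ρ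
insert-cong i {j} refl π≈ρ h with i ≟ h
... | yes _ = refl
... | no _  = cong (punchIn j) (π≈ρ _)

-- A permutation is rebuilt from the image of `zero` and the permutation left after removing `zero`.
-- Permutations are compared pointwise, so occurrence in the list is up to `Perm.≈`.
permutations-complete : ∀ n (π : Permutation′ n) → Any (π Perm.≈_) (permutations n)
permutations-complete zero    π = here λ ()
permutations-complete (suc n) π = cartesianProductWith⁺ (insert zero)
  (λ {j} {ρ} π0≡j rem≈ρ h → trans (sym (insert-remove zero π h))
                       (insert-cong zero {π = remove zero π} {ρ = ρ} π0≡j rem≈ρ h))
  (∈-allFin (π ⟨$⟩ʳ zero)) (permutations-complete n (remove zero π))

lemma4p1 : (m : ℕ) (A : Set) (G : LabelledGraph (2 + m) A) (v₁ k : Fin (2 + m))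
    (k≢v₁ : k ≢ v₁) (v₁≁k : ¬ LabelledGraph.Adjacent G v₁ k)
    (simple : SimpleCollapse (LabelledGraph.graph G) k≢v₁ v₁≁k) →
    (∃ λ (Cs : List (Matrix (Fin (2 ^ (1 + m))) (Fin (2 ^ m)))) →
    Cs ≢ [] ×
    (∀ C → Any (C ≈ᴹ_) Cs ⇔ (∃₂ λ o o′ → IsCollapseMatrix G k≢v₁ v₁≁k simple o o′ C))) ×
    (∀ o o′ → ∃ λ C → IsCollapseMatrix G k≢v₁ v₁≁k simple o o′ C) ×
    (∀ o′ → ∃ λ b → BlockOrder k≢v₁ b o′)
lemma4p1 m A G v₁ k k≢v₁ v₁≁k simple =
  (map rowPermuted (permutations N) , nonempty , λ C → mk⇔ (listed⇒ C) (⇒listed C)) ,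
  -- The inferred witness is `id-over-0` with its rows moved from the block order to `o`.
  (λ o o′ → _ , ≈⇒isCollapseMatrix G k≢v₁ v₁≁k simple o (block o′) o′ (isBlock o′) _ (λ _ _ → refl)) ,
  (λ o′ → block o′ , isBlock o′)
  where
  N = 2 ^ (1 + m)
  block = blockOrder k≢v₁
  isBlock = blockOrder-isBlockOrder k≢v₁

  rowPermuted : Permutation′ N → Matrix (Fin N) (Fin (2 ^ m))
  rowPermuted π h = id-over-0 m (π ⟨$⟩ʳ h)

  listed : ∀ C π → C ≈ᴹ rowPermuted π → Any (C ≈ᴹ_) (map rowPermuted (permutations N))
  listed C π C≈ = map⁺ (Any.map
    (λ π≈ρ h j → trans (C≈ h j) (cong (λ i → id-over-0 m i j) (π≈ρ h)))
    (permutations-complete N π))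

  nonempty : map rowPermuted (permutations N) ≢ []
  nonempty eq with () ← subst (Any (rowPermuted Perm.id ≈ᴹ_)) eq (listed (rowPermuted Perm.id) Perm.id (λ _ _ → refl))

  listed⇒ : ∀ C → Any (C ≈ᴹ_) (map rowPermuted (permutations N)) →
            ∃₂ λ o o′ → IsCollapseMatrix G k≢v₁ v₁≁k simple o o′ C
  listed⇒ C C∈ = o , o′ , ≈⇒isCollapseMatrix G k≢v₁ v₁≁k simple o (block o′) o′ (isBlock o′) C
    (λ h j → trans (proj₂ found h j)
                   (cong (λ i → id-over-0 m i j) (sym (strictlyInverseʳ (block o′) (π ⟨$⟩ʳ h)))))
    where
    found = Any.satisfied (map⁻ C∈)
    π = proj₁ found
    o′ = columnOrder m
    -- Chosen so that column `h` of `o` is column `π ⟨$⟩ʳ h` of the block order, which makes `π` the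
    -- change of order.
    o = Composition.inverse π (block o′)

  ⇒listed : ∀ C → (∃₂ λ o o′ → IsCollapseMatrix G k≢v₁ v₁≁k simple o o′ C) →
            Any (C ≈ᴹ_) (map rowPermuted (permutations N))
  -- Conversely, the permutation is the change from `o` to the block order, sending `h` to the block
  -- position of the `h`-th partition in `o`.
  ⇒listed C (o , o′ , isC) = listed C (Composition.inverse o (Symmetry.inverse (block o′)))
    (isCollapseMatrix⇒≈ G k≢v₁ v₁≁k simple o (block o′) o′ (isBlock o′) C isC)
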